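{- If every vertex of a finite simple graph $G$ has even degree, then $\nu(G)$ is even.
   Context: With $V(G)=\{v_1,\dots,v_n\}$, the closed neighborhood matrix $N(G)$ is the $n\times n$ matrix over $\mathbb{Z}_2$ whose $i$-th column is the characteristic vector of $N[v_i]=\{w : w \text{ adjacent to } v_i \text{ or } w=v_i\}$ (i.e. adjacency matrix plus identity over $\mathbb{Z}_2$). The nullity $\nu(G)$ is the dimension over $\mathbb{Z}_2$ of the kernel of $N(G)$. -}

module Defs where

open import Data.Nat using (ℕ; zero; suc)
open import Data.Nat.Divisibility using (_∣_)
open import Data.Bool using (Bool; true; false; _xor_; _∧_; if_then_else_)
open import Data.Fin using (Fin; zero; suc; _≟_)
open import Data.Fin.Subset using (∣_∣)
open import Data.Vec using (tabulate)
open import Data.Product using (Σ; _×_)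
open import Relation.Nullary.Decidable using (⌊_⌋)
open import Relation.Binary.PropositionalEquality using (_≡_)

-- A finite simple graph on the vertex set Fin n (v_1..v_n ↦ 0..n-1):
-- a symmetric, irreflexive Boolean adjacency relation.
record SimpleGraph (n : ℕ) : Set where
  field
    adj     : Fin n → Fin n → Bool
    symm    : ∀ i j → adj i j ≡ adj j i
    irrefl  : ∀ i → adj i i ≡ false
open SimpleGraph public

degree : ∀ {n} → SimpleGraph n → Fin n → ℕ
degree G i = ∣ tabulate (adj G i) ∣

-- Z₂ = Bool with xor as addition and ∧ as multiplication;
-- vectors in Z₂^n are functions Fin n → Bool.
Vec₂ : ℕ → Set
Vec₂ n = Fin n → Bool

⊕ : ∀ {m} → (Fin m → Bool) → Bool
⊕ {zero}  f = false
⊕ {suc m} f = f zero xor ⊕ {m} (λ k → f (suc k))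

δ : ∀ {n} → Fin n → Fin n → Bool
δ i j = ⌊ i ≟ j ⌋

N : ∀ {n} → SimpleGraph n → Fin n → Fin n → Bool
N G i j = adj G i j xor δ i j

InKernel : ∀ {n} → SimpleGraph n → Vec₂ n → Set
InKernel {n} G x = ∀ i → ⊕ (λ j → N G i j ∧ x j) ≡ false

lincomb : ∀ {n d} → (Fin d → Vec₂ n) → (Fin d → Bool) → Vec₂ n
lincomb v c i = ⊕ (λ k → c k ∧ v k i)

LinIndep : ∀ {n d} → (Fin d → Vec₂ n) → Set
LinIndep v = ∀ c → (∀ i → lincomb v c i ≡ false) → ∀ k → c k ≡ false

IsKernelBasis : ∀ {n d} → SimpleGraph n → (Fin d → Vec₂ n) → Set
IsKernelBasis {n} {d} G v =
  (∀ k → InKernel G (v k)) ×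
  LinIndep v ×
  (∀ x → InKernel G x → Σ (Fin d → Bool) (λ c → ∀ i → lincomb v c i ≡ x i))

IsNullity : ∀ {n} → SimpleGraph n → ℕ → Set
IsNullity {n} G d = Σ (Fin d → Vec₂ n) (IsKernelBasis G)

Even : ℕ → Set
Even d = 2 ∣ d

-- For a symmetric matrix M over ℤ₂ and any z with M z = diag M,
-- dim ker M ≡ n + z · diag M (mod 2).  This survives each step of symmetric
-- Gaussian elimination, which works on an active set A of coordinates (n being
-- its size, kernels being taken among vectors supported on A): removing a
-- coordinate i with M i i = 1 via the Schur complement keeps the kernel
-- dimension and flips both n and z · diag M; removing a coordinate whose row
-- vanishes splits eᵢ off the kernel; removing a pair i, j with M i i = M j j = 0
-- and M i j = 1 via the Schur complement of that 2 × 2 block changes no parity.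
-- For M = N(G) the row sums are deg v + 1, odd when all degrees are even, so
-- z = 𝟙 solves M z = 𝟙 = diag M, and n + 𝟙 · 𝟙 = 2n is even.

module Submission where

open import Defs
open import Data.Nat using (ℕ; zero; suc; _*_; _≤_; _<_; s≤s)
open import Data.Nat.Divisibility using (divides; _∣0; ∣-refl; ∣m∣n⇒∣m+n)
open import Data.Nat.Induction using (<-wellFounded)
open import Data.Nat.Properties using (≤-antisym; ≰⇒>; _≤?_; <-trans; n<1+n)
open import Data.Bool using (Bool; true; false; _xor_; _∧_; not; T)
open import Data.Bool.Properties
  using (xor-∧-commutativeRing; xor-same; xor-identityʳ; ∧-identityʳ; ∧-zeroʳ; ∧-comm; ∧-idem;
         not-involutive; ¬-not; not-¬; ∧-conicalˡ; ∧-conicalʳ; T-∧)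
  renaming (_≟_ to _≟ᵇ_)
open import Data.Fin using (Fin; zero; suc; _≟_; punchIn; punchOut)
open import Data.Fin.Properties using (any?; punchIn-punchOut)
open import Data.Fin.Subset using (∣_∣)
open import Data.Vec using (tabulate)
open import Data.Vec.Properties using (tabulate-cong)
open import Data.Vec.Functional using (_∷_)
open import Data.Product using (Σ; _×_; _,_; proj₁; proj₂; ∃)
open import Algebra.Bundles using (CommutativeRing)
open import Algebra.Properties.Semiring.Sum (CommutativeRing.semiring xor-∧-commutativeRing)
  using (sum; sum-cong-≗; sum-replicate-zero; ∑-distrib-+; *-distribˡ-sum; ∑-comm)
open import Function using (_∘_; Equivalence)
open import Induction.WellFounded using (Acc; acc)
open import Relation.Binary.PropositionalEquality
open import Relation.Nullary using (Dec; yes; no; contradiction)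
open import Relation.Nullary.Decidable using (⌊_⌋; toWitness)

BoolFun : ℕ → Set
BoolFun zero    = Bool
BoolFun (suc k) = Bool → BoolFun k

_≐_ : ∀ {k} → BoolFun k → BoolFun k → Set
_≐_ {zero}  x y = x ≡ y
_≐_ {suc k} f g = ∀ b → f b ≐ g b

agree : ∀ {k} → BoolFun k → BoolFun k → Bool
agree {zero}  x y = ⌊ x ≟ᵇ y ⌋
agree {suc k} f g = agree (f false) (g false) ∧ agree (f true) (g true)

truth-table : ∀ k {f g : BoolFun k} → T (agree f g) → f ≐ g
truth-table zero          agreement       = toWitness agreement
truth-table (suc k) {f} {g} agreement false =
  truth-table k (proj₁ (Equivalence.to (T-∧ {agree (f false) (g false)}) agreement))
truth-table (suc k) {f} {g} agreement true  =
  truth-table k (proj₂ (Equivalence.to (T-∧ {agree (f false) (g false)}) agreement))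

cong₃ : ∀ {A B C D : Set} (f : A → B → C → D) {a a′ b b′ c c′} →
        a ≡ a′ → b ≡ b′ → c ≡ c′ → f a b c ≡ f a′ b′ c′
cong₃ f refl refl refl = refl

-- Sums over ℤ₂

⊕≡sum : ∀ {m} (f : Fin m → Bool) → ⊕ f ≡ sum f
⊕≡sum {zero}  f = refl
⊕≡sum {suc m} f = cong (f zero xor_) (⊕≡sum (f ∘ suc))

⊕-cong : ∀ {m} {f g : Fin m → Bool} → f ≗ g → ⊕ f ≡ ⊕ g
⊕-cong {f = f} {g} f≗g = trans (⊕≡sum f) (trans (sum-cong-≗ f≗g) (sym (⊕≡sum g)))

⊕-zero : ∀ {m} {f : Fin m → Bool} → (∀ k → f k ≡ false) → ⊕ f ≡ false
⊕-zero {m} f≗0 = trans (⊕-cong f≗0) (trans (⊕≡sum {m} (λ _ → false)) (sum-replicate-zero m))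

⊕-xor : ∀ {m} (f g : Fin m → Bool) → ⊕ (λ k → f k xor g k) ≡ ⊕ f xor ⊕ g
⊕-xor f g = trans (⊕≡sum (λ k → f k xor g k)) (trans (∑-distrib-+ f g) (sym (cong₂ _xor_ (⊕≡sum f) (⊕≡sum g))))

⊕-∧ˡ : ∀ {m} b (f : Fin m → Bool) → ⊕ (λ k → b ∧ f k) ≡ b ∧ ⊕ f
⊕-∧ˡ b f = trans (⊕≡sum (λ k → b ∧ f k)) (trans (sym (*-distribˡ-sum b f)) (cong (b ∧_) (sym (⊕≡sum f))))

⊕-comm : ∀ {m p} (f : Fin m → Fin p → Bool) → ⊕ (λ k → ⊕ (f k)) ≡ ⊕ (λ l → ⊕ (λ k → f k l))
⊕-comm f = begin
  ⊕ (λ k → ⊕ (f k))                ≡⟨ ⊕-cong (λ k → ⊕≡sum (f k)) ⟩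
  ⊕ (λ k → sum (f k))              ≡⟨ ⊕≡sum (λ k → sum (f k)) ⟩
  sum (λ k → sum (f k))            ≡⟨ ∑-comm f ⟩
  sum (λ l → sum (λ k → f k l))    ≡⟨ sym (⊕≡sum (λ l → sum (λ k → f k l))) ⟩
  ⊕ (λ l → sum (λ k → f k l))      ≡⟨ ⊕-cong (λ l → sym (⊕≡sum (λ k → f k l))) ⟩
  ⊕ (λ l → ⊕ (λ k → f k l))        ∎
  where open ≡-Reasoning

δ-suc : ∀ {m} (a k : Fin m) → δ (suc a) (suc k) ≡ δ a k
δ-suc a k with a ≟ k
... | yes _ = refl
... | no  _ = refl

δ-refl : ∀ {m} (a : Fin m) → δ a a ≡ true
δ-refl zero    = refl
δ-refl (suc a) = trans (δ-suc a a) (δ-refl a)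

δ-≢ : ∀ {m} {a b : Fin m} → a ≢ b → δ a b ≡ false
δ-≢ {a = a} {b} a≢b with a ≟ b
... | yes a≡b = contradiction a≡b a≢b
... | no  _   = refl

δ-sym : ∀ {m} (a b : Fin m) → δ a b ≡ δ b a
δ-sym a b with a ≟ b
... | yes refl = sym (δ-refl a)
... | no  a≢b  = sym (δ-≢ (a≢b ∘ sym))

⊕-δ : ∀ {m} (a : Fin m) (g : Fin m → Bool) → ⊕ (λ k → δ a k ∧ g k) ≡ g a
⊕-δ {suc m} zero    g = trans (cong (g zero xor_) (⊕-zero {m} (λ _ → refl))) (xor-identityʳ (g zero))
⊕-δ         (suc a) g = trans (⊕-cong (λ k → cong (_∧ g (suc k)) (δ-suc a k))) (⊕-δ a (g ∘ suc))

⊕-δ-self : ∀ {m} (a : Fin m) → ⊕ (δ a) ≡ true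
⊕-δ-self a = trans (⊕-cong (λ k → sym (∧-identityʳ (δ a k)))) (⊕-δ a (λ _ → true))

-- The standard inner product and transvections

infix 7 _·_

_·_ : ∀ {n} → Vec₂ n → Vec₂ n → Bool
r · x = ⊕ (λ l → r l ∧ x l)

·-comm : ∀ {n} (r x : Vec₂ n) → r · x ≡ x · r
·-comm r x = ⊕-cong (λ l → ∧-comm (r l) (x l))

·-congʳ : ∀ {n} (r : Vec₂ n) {x y : Vec₂ n} → x ≗ y → r · x ≡ r · y
·-congʳ r x≗y = ⊕-cong (λ l → cong (r l ∧_) (x≗y l))

·-congˡ : ∀ {n} {r s : Vec₂ n} → r ≗ s → ∀ x → r · x ≡ s · x
·-congˡ r≗s x = ⊕-cong (λ l → cong (_∧ x l) (r≗s l))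

·-zeroˡ : ∀ {n} {r : Vec₂ n} (y : Vec₂ n) → (∀ l → r l ≡ false) → r · y ≡ false
·-zeroˡ y r≡0 = ⊕-zero (λ l → cong (_∧ y l) (r≡0 l))

·-δʳ : ∀ {n} (r : Vec₂ n) a → r · δ a ≡ r a
·-δʳ r a = trans (⊕-cong (λ l → ∧-comm (r l) (δ a l))) (⊕-δ a r)

δ-· : ∀ {n} a (x : Vec₂ n) → δ a · x ≡ x a
δ-· a x = ⊕-δ a x

·-axpy : ∀ {n} (r : Vec₂ n) b s y → (λ l → r l xor b ∧ s l) · y ≡ r · y xor b ∧ s · y
·-axpy r b s y = begin
  ⊕ (λ l → (r l xor b ∧ s l) ∧ y l)      ≡⟨ ⊕-cong (λ l → distrib (r l) b (s l) (y l)) ⟩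
  ⊕ (λ l → r l ∧ y l xor b ∧ s l ∧ y l)  ≡⟨ ⊕-xor (λ l → r l ∧ y l) (λ l → b ∧ s l ∧ y l) ⟩
  r · y xor ⊕ (λ l → b ∧ s l ∧ y l)      ≡⟨ cong (r · y xor_) (⊕-∧ˡ b (λ l → s l ∧ y l)) ⟩
  r · y xor b ∧ s · y                    ∎
  where
  open ≡-Reasoning
  distrib : ∀ r b s y → (r xor b ∧ s) ∧ y ≡ r ∧ y xor b ∧ s ∧ y
  distrib = truth-table 4 _

·-lincomb : ∀ {n d} (r : Vec₂ n) (w : Fin d → Vec₂ n) c → r · lincomb w c ≡ ⊕ (λ t → c t ∧ r · w t)
·-lincomb r w c = begin
  ⊕ (λ l → r l ∧ ⊕ (λ t → c t ∧ w t l))    ≡⟨ ⊕-cong (λ l → sym (⊕-∧ˡ (r l) (λ t → c t ∧ w t l))) ⟩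
  ⊕ (λ l → ⊕ (λ t → r l ∧ c t ∧ w t l))    ≡⟨ ⊕-comm (λ l t → r l ∧ c t ∧ w t l) ⟩
  ⊕ (λ t → ⊕ (λ l → r l ∧ c t ∧ w t l))    ≡⟨ ⊕-cong (λ t → ⊕-cong (λ l → swap (r l) (c t) (w t l))) ⟩
  ⊕ (λ t → ⊕ (λ l → c t ∧ r l ∧ w t l))    ≡⟨ ⊕-cong (λ t → ⊕-∧ˡ (c t) (λ l → r l ∧ w t l)) ⟩
  ⊕ (λ t → c t ∧ r · w t)                  ∎
  where
  open ≡-Reasoning
  swap : ∀ a b c → a ∧ b ∧ c ≡ b ∧ a ∧ c
  swap = truth-table 3 _

record Linear {n} (f : Vec₂ n → Vec₂ n) : Set where
  field
    cong-≗          : ∀ {x y} → x ≗ y → f x ≗ f y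
    lincomb-commute : ∀ {d} (w : Fin d → Vec₂ n) c → lincomb (f ∘ w) c ≗ f (lincomb w c)

  -- The empty linear combination is the zero vector.
  zero-preserving : ∀ {x} → x ≗ (λ _ → false) → f x ≗ (λ _ → false)
  zero-preserving x≗0 k = trans (cong-≗ x≗0 k) (sym (lincomb-commute {d = 0} (λ ()) (λ ()) k))

Linear-∘ : ∀ {n} {f g : Vec₂ n → Vec₂ n} → Linear f → Linear g → Linear (f ∘ g)
Linear-∘ {g = g} f-linear g-linear = record
  { cong-≗          = λ x≗y → F.cong-≗ (G.cong-≗ x≗y)
  ; lincomb-commute = λ w c k → trans (F.lincomb-commute (g ∘ w) c k) (F.cong-≗ (G.lincomb-commute w c) k)
  }
  where
  module F = Linear f-linear
  module G = Linear g-linear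

transvection : ∀ {n} → Vec₂ n → Vec₂ n → Vec₂ n → Vec₂ n
transvection e s x k = x k xor e k ∧ s · x

-- clear a x = x + xₐ eₐ is x with its a-th coordinate set to zero.
clear : ∀ {n} → Fin n → Vec₂ n → Vec₂ n
clear a = transvection (δ a) (δ a)

·-transvection : ∀ {n} (r e s x : Vec₂ n) → r · transvection e s x ≡ r · x xor r · e ∧ s · x
·-transvection r e s x = begin
  ⊕ (λ l → r l ∧ (x l xor e l ∧ s · x))      ≡⟨ ⊕-cong (λ l → distrib (r l) (x l) (e l) (s · x)) ⟩
  ⊕ (λ l → r l ∧ x l xor s · x ∧ r l ∧ e l)  ≡⟨ ⊕-xor (λ l → r l ∧ x l) (λ l → s · x ∧ r l ∧ e l) ⟩
  r · x xor ⊕ (λ l → s · x ∧ r l ∧ e l)      ≡⟨ cong (r · x xor_) (⊕-∧ˡ (s · x) (λ l → r l ∧ e l)) ⟩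
  r · x xor s · x ∧ r · e                    ≡⟨ cong (r · x xor_) (∧-comm (s · x) (r · e)) ⟩
  r · x xor r · e ∧ s · x                    ∎
  where
  open ≡-Reasoning
  distrib : ∀ r x e s → r ∧ (x xor e ∧ s) ≡ r ∧ x xor s ∧ r ∧ e
  distrib = truth-table 4 _

·-transvectionᵟ : ∀ {n} (r : Vec₂ n) a s x → r · transvection (δ a) s x ≡ r · x xor r a ∧ s · x
·-transvectionᵟ r a s x = trans (·-transvection r (δ a) s x) (cong (λ v → r · x xor v ∧ s · x) (·-δʳ r a))

·-clear : ∀ {n} (r : Vec₂ n) a x → r · clear a x ≡ r · x xor r a ∧ x a
·-clear r a x = trans (·-transvectionᵟ r a (δ a) x) (cong (λ v → r · x xor r a ∧ v) (δ-· a x))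

·-clear-irrelevant : ∀ {n} {r : Vec₂ n} {a} x → r a ≡ false → r · clear a x ≡ r · x
·-clear-irrelevant {r = r} {a} x ra≡0 =
  trans (·-clear r a x) (trans (cong (λ u → r · x xor u ∧ x a) ra≡0) (xor-identityʳ (r · x)))

transvection-at : ∀ {n} a (s x : Vec₂ n) → transvection (δ a) s x a ≡ x a xor s · x
transvection-at a s x = cong (λ v → x a xor v ∧ s · x) (δ-refl a)

transvection-other : ∀ {n} {a k : Fin n} s x → a ≢ k → transvection (δ a) s x k ≡ x k
transvection-other {k = k} s x a≢k = trans (cong (λ v → x k xor v ∧ s · x) (δ-≢ a≢k)) (xor-identityʳ (x k))

clear-at : ∀ {n} a (x : Vec₂ n) → clear a x a ≡ false
clear-at a x = trans (transvection-at a (δ a) x) (trans (cong (x a xor_) (δ-· a x)) (xor-same (x a)))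

clear-transvection : ∀ {n} {a} (s y : Vec₂ n) → y a ≡ false → clear a (transvection (δ a) s y) ≗ y
clear-transvection {a = a} s y ya≡0 k = by-cases (a ≟ k)
  where
  by-cases : Dec (a ≡ k) → clear a (transvection (δ a) s y) k ≡ y k
  by-cases (yes refl) = trans (clear-at a (transvection (δ a) s y)) (sym ya≡0)
  by-cases (no  a≢k)  = trans (transvection-other (δ a) (transvection (δ a) s y) a≢k) (transvection-other s y a≢k)

transvection-linear : ∀ {n} (e s : Vec₂ n) → Linear (transvection e s)
transvection-linear e s = record
  { cong-≗          = λ x≗y k → cong₂ (λ u v → u xor e k ∧ v) (x≗y k) (·-congʳ s x≗y)
  ; lincomb-commute = commute
  }
  where
  commute : ∀ {d} (w : Fin d → Vec₂ _) c → lincomb (transvection e s ∘ w) c ≗ transvection e s (lincomb w c)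
  commute w c k = begin
    ⊕ (λ t → c t ∧ (w t k xor e k ∧ s · w t))
      ≡⟨ ⊕-cong (λ t → distrib (c t) (w t k) (e k) (s · w t)) ⟩
    ⊕ (λ t → c t ∧ w t k xor e k ∧ c t ∧ s · w t)
      ≡⟨ ⊕-xor (λ t → c t ∧ w t k) (λ t → e k ∧ c t ∧ s · w t) ⟩
    lincomb w c k xor ⊕ (λ t → e k ∧ c t ∧ s · w t)
      ≡⟨ cong (lincomb w c k xor_) (⊕-∧ˡ (e k) (λ t → c t ∧ s · w t)) ⟩
    lincomb w c k xor e k ∧ ⊕ (λ t → c t ∧ s · w t)
      ≡⟨ cong (λ v → lincomb w c k xor e k ∧ v) (sym (·-lincomb s w c)) ⟩
    lincomb w c k xor e k ∧ s · lincomb w c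
      ∎
    where
    open ≡-Reasoning
    distrib : ∀ c x e s → c ∧ (x xor e ∧ s) ≡ c ∧ x xor e ∧ c ∧ s
    distrib = truth-table 4 _

-- Bases and the invariance of dimension

Basis : ∀ {n d} → (Vec₂ n → Set) → (Fin d → Vec₂ n) → Set
Basis {n} {d} P w = (∀ t → P (w t)) × LinIndep w × (∀ x → P x → Σ (Fin d → Bool) λ c → lincomb w c ≗ x)

lincomb-congˡ : ∀ {n d} {v v′ : Fin d → Vec₂ n} → (∀ t → v t ≗ v′ t) → ∀ c → lincomb v c ≗ lincomb v′ c
lincomb-congˡ v≗v′ c k = ⊕-cong (λ t → cong (c t ∧_) (v≗v′ t k))

lincomb-lincomb : ∀ {n m p} (w : Fin m → Vec₂ n) (a : Fin p → Fin m → Bool) c →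
                  lincomb (λ k → lincomb w (a k)) c ≗ lincomb w (lincomb a c)
lincomb-lincomb w a c i = begin
  ⊕ (λ k → c k ∧ a k · column)   ≡⟨ ⊕-cong (λ k → cong (c k ∧_) (·-comm (a k) column)) ⟩
  ⊕ (λ k → c k ∧ column · a k)   ≡⟨ sym (·-lincomb column a c) ⟩
  column · lincomb a c           ≡⟨ ·-comm column (lincomb a c) ⟩
  lincomb a c · column           ∎
  where
  open ≡-Reasoning
  column : Vec₂ _
  column l = w l i

NontrivialRelation : ∀ {m p} → (Fin p → Vec₂ m) → Set
NontrivialRelation {p = p} a = Σ (Fin p → Bool) λ c → (∃ λ k → c k ≡ true) × lincomb a c ≗ (λ _ → false)

-- If a₀ l₀ = 1, adding multiples of a₀ moves a₁, a₂, … into the coordinate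
-- hyperplane l₀ = 0, a copy of ℤ₂^(m - 1), where induction applies.
m<p⇒dependent : ∀ {m p} → m < p → (a : Fin p → Vec₂ m) → NontrivialRelation a
m<p⇒dependent {p = suc p} m<p a with any? (λ l → a zero l ≟ᵇ true)
... | no a₀≡0 = δ zero , (zero , refl) , λ l → trans (⊕-δ zero (λ k → a k l)) (¬-not (λ e → a₀≡0 (l , e)))
m<p⇒dependent {suc m} {suc p} (s≤s m<p) a | yes (l₀ , a₀l₀≡1) =
  c , (suc (proj₁ nontrivial) , proj₂ nontrivial) , relation
  where
  eliminate : Vec₂ (suc m) → Vec₂ (suc m)
  eliminate = transvection (a zero) (δ l₀)
  reduced : Fin p → Vec₂ m
  reduced k l = eliminate (a (suc k)) (punchIn l₀ l)
  IH = m<p⇒dependent m<p reduced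
  c′ = proj₁ IH
  nontrivial = proj₁ (proj₂ IH)
  v = lincomb (a ∘ suc) c′
  c : Fin (suc p) → Bool
  c = v l₀ ∷ c′
  relation : lincomb a c ≗ (λ _ → false)
  relation L with l₀ ≟ L
  ... | yes refl = trans (cong (λ u → v l₀ ∧ u xor v l₀) a₀l₀≡1) (pivot-cancels (v l₀))
    where
    pivot-cancels : ∀ b → b ∧ true xor b ≡ false
    pivot-cancels = truth-table 1 _
  ... | no l₀≢L = begin
    v l₀ ∧ a zero L xor v L                 ≡⟨ swap (v l₀) (a zero L) (v L) ⟩
    v L xor a zero L ∧ v l₀                 ≡⟨ cong (λ u → v L xor a zero L ∧ u) (sym (δ-· l₀ v)) ⟩
    eliminate v L
      ≡⟨ sym (Linear.lincomb-commute (transvection-linear (a zero) (δ l₀)) (a ∘ suc) c′ L) ⟩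
    lincomb (eliminate ∘ a ∘ suc) c′ L
      ≡⟨ cong (lincomb (eliminate ∘ a ∘ suc) c′) (sym (punchIn-punchOut l₀≢L)) ⟩
    lincomb reduced c′ (punchOut l₀≢L)      ≡⟨ proj₂ (proj₂ IH) (punchOut l₀≢L) ⟩
    false                                   ∎
    where
    open ≡-Reasoning
    swap : ∀ b e x → b ∧ e xor x ≡ x xor e ∧ b
    swap = truth-table 3 _

independent⇒≤ : ∀ {n p m} (u : Fin p → Vec₂ n) (w : Fin m → Vec₂ n) → LinIndep u →
                (∀ k → Σ (Fin m → Bool) λ a → lincomb w a ≗ u k) → p ≤ m
independent⇒≤ {p = p} {m} u w u-indep u∈span with p ≤? m
... | yes p≤m = p≤m
... | no  p≰m = contradiction (u-indep c u-relation k) (not-¬ ck≡true)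
  where
  a : Fin p → Fin m → Bool
  a k = proj₁ (u∈span k)
  dependence = m<p⇒dependent (≰⇒> p≰m) a
  c = proj₁ dependence
  k = proj₁ (proj₁ (proj₂ dependence))
  ck≡true = proj₂ (proj₁ (proj₂ dependence))
  u-relation : lincomb u c ≗ (λ _ → false)
  u-relation i = begin
    lincomb u c i                           ≡⟨ lincomb-congˡ (λ k → sym ∘ proj₂ (u∈span k)) c i ⟩
    lincomb (λ k → lincomb w (a k)) c i     ≡⟨ lincomb-lincomb w a c i ⟩
    lincomb w (lincomb a c) i               ≡⟨ ⊕-zero (λ l → cong (_∧ w l i) (proj₂ (proj₂ dependence) l)) ⟩
    false                                   ∎
    where open ≡-Reasoning

Basis-size-unique : ∀ {n p m} {P : Vec₂ n → Set} {u : Fin p → Vec₂ n} {w : Fin m → Vec₂ n} →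
                    Basis P u → Basis P w → p ≡ m
Basis-size-unique {u = u} {w} (u∈P , u-indep , u-spans) (w∈P , w-indep , w-spans) =
  ≤-antisym (independent⇒≤ u w u-indep (λ k → w-spans (u k) (u∈P k)))
            (independent⇒≤ w u w-indep (λ k → u-spans (w k) (w∈P k)))

record _≃_ {n} (P Q : Vec₂ n → Set) : Set where
  field
    to          : Vec₂ n → Vec₂ n
    from        : Vec₂ n → Vec₂ n
    to-linear   : Linear to
    from-linear : Linear from
    to-∈        : ∀ {x} → P x → Q (to x)
    from-∈      : ∀ {y} → Q y → P (from y)
    to∘from     : ∀ {y} → Q y → to (from y) ≗ y
    from∘to     : ∀ {x} → P x → from (to x) ≗ x

Basis-transport : ∀ {n d} {P Q : Vec₂ n → Set} {w : Fin d → Vec₂ n} →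
                  (iso : P ≃ Q) → Basis Q w → Basis P (_≃_.from iso ∘ w)
Basis-transport {d = d} {P = P} {w = w} iso (w∈Q , w-indep , w-spans) =
  (λ t → from-∈ (w∈Q t)) , independent , spans
  where
  open _≃_ iso
  open Linear to-linear using (zero-preserving)
  independent : LinIndep (from ∘ w)
  independent c relation = w-indep c λ k → begin
    lincomb w c k                    ≡⟨ lincomb-congˡ (λ t → sym ∘ to∘from (w∈Q t)) c k ⟩
    lincomb (to ∘ from ∘ w) c k      ≡⟨ Linear.lincomb-commute to-linear (from ∘ w) c k ⟩
    to (lincomb (from ∘ w) c) k      ≡⟨ zero-preserving relation k ⟩
    false                            ∎
    where open ≡-Reasoning
  spans : ∀ x → P x → Σ (Fin d → Bool) λ c → lincomb (from ∘ w) c ≗ x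
  spans x x∈P = c , λ k → begin
    lincomb (from ∘ w) c k     ≡⟨ Linear.lincomb-commute from-linear w c k ⟩
    from (lincomb w c) k       ≡⟨ Linear.cong-≗ from-linear c-spans k ⟩
    from (to x) k              ≡⟨ from∘to x∈P k ⟩
    x k                        ∎
    where
    open ≡-Reasoning
    c = proj₁ (w-spans (to x) (to-∈ x∈P))
    c-spans = proj₂ (w-spans (to x) (to-∈ x∈P))

Basis-resp-⇔ : ∀ {n d} {P Q : Vec₂ n → Set} {w : Fin d → Vec₂ n} →
               (∀ {x} → P x → Q x) → (∀ {x} → Q x → P x) → Basis P w → Basis Q w
Basis-resp-⇔ P⇒Q Q⇒P (w∈P , w-indep , w-spans) = P⇒Q ∘ w∈P , w-indep , λ x → w-spans x ∘ Q⇒P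

Basis-∷ : ∀ {n d} {P : Vec₂ n → Set} {i} {w : Fin d → Vec₂ n} →
          P (δ i) → (∀ {x} → P x → P (clear i x)) →
          Basis (λ x → P x × x i ≡ false) w → Basis P (δ i ∷ w)
Basis-∷ {d = d} {P = P} {i} {w} δi∈P clear-closed (w∈Q , w-indep , w-spans) = members , independent , spans
  where
  members : ∀ t → P ((δ i ∷ w) t)
  members zero    = δi∈P
  members (suc t) = proj₁ (w∈Q t)
  independent : LinIndep (δ i ∷ w)
  independent c relation = coefficients
    where
    rest-vanishes-at-i : lincomb w (c ∘ suc) i ≡ false
    rest-vanishes-at-i = ⊕-zero (λ t → trans (cong (c (suc t) ∧_) (proj₂ (w∈Q t))) (∧-zeroʳ (c (suc t))))
    head≡false : c zero ≡ false
    head≡false = begin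
      c zero                                    ≡⟨ sym (∧-identityʳ (c zero)) ⟩
      c zero ∧ true                             ≡⟨ sym (xor-identityʳ _) ⟩
      c zero ∧ true xor false                   ≡⟨ cong₂ (λ u v → c zero ∧ u xor v) (sym (δ-refl i)) (sym rest-vanishes-at-i) ⟩
      c zero ∧ δ i i xor lincomb w (c ∘ suc) i  ≡⟨ relation i ⟩
      false                                     ∎
      where open ≡-Reasoning
    coefficients : ∀ t → c t ≡ false
    coefficients zero    = head≡false
    coefficients (suc t) = w-indep (c ∘ suc) rest-vanishes t
      where
      rest-vanishes : lincomb w (c ∘ suc) ≗ (λ _ → false)
      rest-vanishes k = trans (cong (λ b → b ∧ δ i k xor lincomb w (c ∘ suc) k) (sym head≡false)) (relation k)
  spans : ∀ x → P x → Σ (Fin (suc d) → Bool) λ c → lincomb (δ i ∷ w) c ≗ x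
  spans x x∈P = x i ∷ c′ , λ k → begin
    x i ∧ δ i k xor lincomb w c′ k            ≡⟨ cong (x i ∧ δ i k xor_) (c′-spans k) ⟩
    x i ∧ δ i k xor (x k xor δ i k ∧ δ i · x) ≡⟨ cong (λ u → x i ∧ δ i k xor (x k xor δ i k ∧ u)) (δ-· i x) ⟩
    x i ∧ δ i k xor (x k xor δ i k ∧ x i)     ≡⟨ cancel (x i) (δ i k) (x k) ⟩
    x k                                       ∎
    where
    open ≡-Reasoning
    c′ = proj₁ (w-spans (clear i x) (clear-closed x∈P , clear-at i x))
    c′-spans = proj₂ (w-spans (clear i x) (clear-closed x∈P , clear-at i x))
    cancel : ∀ a d x → a ∧ d xor (x xor d ∧ a) ≡ x
    cancel = truth-table 3 _

-- Active sets of coordinates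

remove : ∀ {n} → Fin n → (Fin n → Bool) → Fin n → Bool
remove i A k = not (δ i k) ∧ A k

remove-at : ∀ {n} i (A : Fin n → Bool) → remove i A i ≡ false
remove-at i A = cong (λ u → not u ∧ A i) (δ-refl i)

remove-other : ∀ {n} {i k} (A : Fin n → Bool) → i ≢ k → remove i A k ≡ A k
remove-other A i≢k = cong (λ u → not u ∧ A _) (δ-≢ i≢k)

remove-⊆ : ∀ {n} {i k} (A : Fin n → Bool) → remove i A k ≡ true → A k ≡ true
remove-⊆ {i = i} {k} A = ∧-conicalʳ (not (δ i k)) (A k)

⊕-remove : ∀ {n} {i} (A : Fin n → Bool) → A i ≡ true → ⊕ (remove i A) ≡ ⊕ A xor true
⊕-remove {i = i} A i∈A = begin
  ⊕ (remove i A)               ≡⟨ ⊕-cong toggles-i ⟩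
  ⊕ (λ k → A k xor δ i k)      ≡⟨ ⊕-xor A (δ i) ⟩
  ⊕ A xor ⊕ (δ i)              ≡⟨ cong (⊕ A xor_) (⊕-δ-self i) ⟩
  ⊕ A xor true                 ∎
  where
  open ≡-Reasoning
  toggles-i : ∀ k → remove i A k ≡ A k xor δ i k
  toggles-i k with i ≟ k
  ... | yes refl = sym (cong (_xor true) i∈A)
  ... | no  _    = sym (xor-identityʳ (A k))

size : ∀ {n} → (Fin n → Bool) → ℕ
size A = ∣ tabulate A ∣

size-cong : ∀ {n} {A B : Fin n → Bool} → A ≗ B → size A ≡ size B
size-cong A≗B = cong ∣_∣ (tabulate-cong A≗B)

remove-suc : ∀ {n} i (A : Fin (suc n) → Bool) → remove (suc i) A ∘ suc ≗ remove i (A ∘ suc)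
remove-suc i A k = cong (λ u → not u ∧ A (suc k)) (δ-suc i k)

size-remove : ∀ {n} {i} (A : Fin n → Bool) → A i ≡ true → size (remove i A) < size A
size-remove {i = zero}  A i∈A rewrite i∈A = n<1+n _
size-remove {i = suc i} A i∈A rewrite size-cong (remove-suc i A) with A zero
... | true  = s≤s (size-remove (A ∘ suc) i∈A)
... | false = size-remove (A ∘ suc) i∈A

Supported : ∀ {n} → (Fin n → Bool) → Vec₂ n → Set
Supported A x = ∀ k → A k ≡ false → x k ≡ false

Supported-remove⁻ : ∀ {n} {A : Fin n → Bool} {i x} → Supported (remove i A) x → Supported A x
Supported-remove⁻ {i = i} x-supp k k∉A = x-supp k (trans (cong (not (δ i k) ∧_) k∉A) (∧-zeroʳ _))

Supported-remove⁺ : ∀ {n} {A : Fin n → Bool} {i x} → Supported A x → x i ≡ false → Supported (remove i A) x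
Supported-remove⁺ {i = i} x-supp xi≡0 k k∉A′ with i ≟ k
... | yes refl = xi≡0
... | no  _    = x-supp k k∉A′

clear-supported : ∀ {n} {A : Fin n → Bool} {i x} → Supported A x → Supported (remove i A) (clear i x)
clear-supported {i = i} {x} x-supp k k∉A′ with i ≟ k
... | yes refl = trans (cong (x i xor_) (δ-· i x)) (xor-same (x i))
... | no  _    = trans (xor-identityʳ (x k)) (x-supp k k∉A′)

transvection-supported : ∀ {n} {A : Fin n → Bool} {a s x} → A a ≡ true → Supported A x →
                         Supported A (transvection (δ a) s x)
transvection-supported {a = a} {x = x} a∈A x-supp k k∉A with a ≟ k
... | yes refl = contradiction (trans (sym a∈A) k∉A) λ ()
... | no  _    = trans (xor-identityʳ (x k)) (x-supp k k∉A)

·-vanish : ∀ {n} {A : Fin n → Bool} {r x : Vec₂ n} → Supported A x → (∀ j → A j ≡ true → r j ≡ false) → r · x ≡ false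
·-vanish {A = A} {r} {x} x-supp r-vanishes = ⊕-zero vanishes
  where
  vanishes : ∀ j → r j ∧ x j ≡ false
  vanishes j with A j in eq
  ... | true  = cong (_∧ x j) (r-vanishes j eq)
  ... | false = trans (cong (r j ∧_) (x-supp j eq)) (∧-zeroʳ (r j))

-- Symmetric elimination

Matrix : ℕ → Set
Matrix n = Fin n → Fin n → Bool

Symmetric : ∀ {n} → Matrix n → Set
Symmetric M = ∀ k l → M k l ≡ M l k

diag : ∀ {n} → Matrix n → Vec₂ n
diag M k = M k k

SolvesOn : ∀ {n} → (Fin n → Bool) → Matrix n → Vec₂ n → Vec₂ n → Set
SolvesOn A M b x = Supported A x × (∀ l → A l ≡ true → M l · x ≡ b l)

Ker : ∀ {n} → (Fin n → Bool) → Matrix n → Vec₂ n → Set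
Ker A M = SolvesOn A M (λ _ → false)

parity : ℕ → Bool
parity zero    = false
parity (suc m) = not (parity m)

KernelParity : ∀ {n} → (Fin n → Bool) → Matrix n → Vec₂ n → Set
KernelParity {n} A M z =
  Σ ℕ λ d → Σ (Fin d → Vec₂ n) λ w → Basis (Ker A M) w × parity d ≡ ⊕ A xor diag M · z

record Reduction {n} (A : Fin n → Bool) (M : Matrix n) (z : Vec₂ n) : Set where
  field
    A′        : Fin n → Bool
    M′        : Matrix n
    z′        : Vec₂ n
    smaller   : size A′ < size A
    symmetric : Symmetric M′
    solves    : SolvesOn A′ M′ (diag M′) z′
    lift      : KernelParity A′ M′ z′ → KernelParity A M z

module DiagonalPivot {n} {A : Fin n → Bool} {M : Matrix n} (M-sym : Symmetric M)
                     {i} (i∈A : A i ≡ true) (Mii≡1 : M i i ≡ true) where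

  A′ : Fin n → Bool
  A′ = remove i A

  M′ : Matrix n
  M′ k l = M k l xor M k i ∧ M i l

  ·-M′ : ∀ l y → M′ l · y ≡ M l · y xor M l i ∧ M i · y
  ·-M′ l y = ·-axpy (M l) (M l i) (M i) y

  M′-symmetric : Symmetric M′
  M′-symmetric k l = cong₂ _xor_ (M-sym k l)
    (trans (cong₂ _∧_ (M-sym k i) (M-sym i l)) (∧-comm (M i k) (M l i)))

  M′-row-i : ∀ l → M′ i l ≡ false
  M′-row-i l = trans (cong (λ u → M i l xor u ∧ M i l) Mii≡1) (xor-same (M i l))

  M′-column-i : ∀ l → M′ l i ≡ false
  M′-column-i l = trans (M′-symmetric l i) (M′-row-i l)

  from : Vec₂ n → Vec₂ n
  from = transvection (δ i) (M i)

  ·-from : ∀ l y → M l · from y ≡ M′ l · y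
  ·-from l y = trans (·-transvectionᵟ (M l) i (M i) y) (sym (·-M′ l y))

  isomorphism : Ker A M ≃ Ker A′ M′
  isomorphism = record
    { to          = clear i
    ; from        = from
    ; to-linear   = transvection-linear (δ i) (δ i)
    ; from-linear = transvection-linear (δ i) (M i)
    ; to-∈        = to-∈
    ; from-∈      = from-∈
    ; to∘from     = to∘from
    ; from∘to     = from∘to
    }
    where
    to-∈ : ∀ {x} → Ker A M x → Ker A′ M′ (clear i x)
    to-∈ {x} (x-supp , x∈ker) = clear-supported x-supp , λ l l∈A′ → begin
      M′ l · clear i x                 ≡⟨ ·-clear-irrelevant x (M′-column-i l) ⟩
      M′ l · x                         ≡⟨ ·-M′ l x ⟩
      M l · x xor M l i ∧ M i · x      ≡⟨ cong₂ (λ u v → u xor M l i ∧ v) (x∈ker l (remove-⊆ A l∈A′)) (x∈ker i i∈A) ⟩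
      false xor M l i ∧ false          ≡⟨ ∧-zeroʳ (M l i) ⟩
      false                            ∎
      where open ≡-Reasoning
    from-∈ : ∀ {y} → Ker A′ M′ y → Ker A M (from y)
    from-∈ {y} (y-supp , y∈ker) = transvection-supported i∈A (Supported-remove⁻ y-supp) , λ l l∈A →
      trans (·-from l y) (M′-rows l l∈A)
      where
      M′-rows : ∀ l → A l ≡ true → M′ l · y ≡ false
      M′-rows l l∈A with i ≟ l
      ... | yes refl = ·-zeroˡ y M′-row-i
      ... | no  i≢l  = y∈ker l (trans (remove-other A i≢l) l∈A)
    to∘from : ∀ {y} → Ker A′ M′ y → clear i (from y) ≗ y
    to∘from {y} (y-supp , _) = clear-transvection (M i) y (y-supp i (remove-at i A))
    from∘to : ∀ {x} → Ker A M x → from (clear i x) ≗ x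
    from∘to {x} (_ , x∈ker) k = begin
      clear i x k xor δ i k ∧ M i · clear i x
        ≡⟨ cong (λ u → clear i x k xor δ i k ∧ u) (·-clear (M i) i x) ⟩
      clear i x k xor δ i k ∧ (M i · x xor M i i ∧ x i)
        ≡⟨ cong₂ (λ u v → clear i x k xor δ i k ∧ (u xor v ∧ x i)) (x∈ker i i∈A) Mii≡1 ⟩
      clear i x k xor δ i k ∧ x i
        ≡⟨ cong (λ u → (x k xor δ i k ∧ u) xor δ i k ∧ x i) (δ-· i x) ⟩
      (x k xor δ i k ∧ x i) xor δ i k ∧ x i
        ≡⟨ cancel (x k) (δ i k ∧ x i) ⟩
      x k
        ∎
      where
      open ≡-Reasoning
      cancel : ∀ a b → (a xor b) xor b ≡ a
      cancel = truth-table 2 _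

  module _ {z} (z-solves : SolvesOn A M (diag M) z) where

    z′ : Vec₂ n
    z′ = clear i z

    M′-diag-solution : SolvesOn A′ M′ (diag M′) z′
    M′-diag-solution = clear-supported (proj₁ z-solves) , λ l l∈A′ → begin
      M′ l · clear i z                 ≡⟨ ·-clear-irrelevant z (M′-column-i l) ⟩
      M′ l · z                         ≡⟨ ·-M′ l z ⟩
      M l · z xor M l i ∧ M i · z
        ≡⟨ cong₂ (λ u v → u xor M l i ∧ v) (solves l (remove-⊆ A l∈A′)) (trans (solves i i∈A) Mii≡1) ⟩
      M l l xor M l i ∧ true           ≡⟨ cong (M l l xor_) (∧-identityʳ (M l i)) ⟩
      M l l xor M l i                  ≡⟨ cong (M l l xor_) (sym (∧-idem (M l i))) ⟩
      M l l xor M l i ∧ M l i          ≡⟨ cong (λ u → M l l xor M l i ∧ u) (M-sym l i) ⟩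
      M l l xor M l i ∧ M i l          ∎
      where
      open ≡-Reasoning
      solves = proj₂ z-solves

    diag-M′·z′ : diag M′ · z′ ≡ diag M · z xor true
    diag-M′·z′ = begin
      diag M′ · z′                                       ≡⟨ ·-congˡ diag-M′ z′ ⟩
      (λ k → diag M k xor true ∧ M i k) · z′             ≡⟨ ·-axpy (diag M) true (M i) z′ ⟩
      diag M · z′ xor M i · z′                           ≡⟨ cong₂ _xor_ (·-clear (diag M) i z) (·-clear (M i) i z) ⟩
      (diag M · z xor M i i ∧ z i) xor (M i · z xor M i i ∧ z i)
        ≡⟨ cong₂ (λ u v → (diag M · z xor u ∧ z i) xor (v xor u ∧ z i)) Mii≡1 (trans (proj₂ z-solves i i∈A) Mii≡1) ⟩
      (diag M · z xor z i) xor (true xor z i)            ≡⟨ rearrange (diag M · z) (z i) ⟩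
      diag M · z xor true                                ∎
      where
      open ≡-Reasoning
      diag-M′ : ∀ k → M′ k k ≡ diag M k xor true ∧ M i k
      diag-M′ k = cong (M k k xor_) (trans (cong (_∧ M i k) (M-sym k i)) (∧-idem (M i k)))
      rearrange : ∀ d b → (d xor b) xor (true xor b) ≡ d xor true
      rearrange = truth-table 2 _

    reduction : Reduction A M z
    reduction = record
      { A′        = A′
      ; M′        = M′
      ; z′        = z′
      ; smaller   = size-remove A i∈A
      ; symmetric = M′-symmetric
      ; solves    = M′-diag-solution
      ; lift      = λ (d , w , w-basis , parity-d) →
          d , from ∘ w , Basis-transport isomorphism w-basis ,
          trans parity-d (trans (cong₂ _xor_ (⊕-remove A i∈A) diag-M′·z′) (rearrange (⊕ A) (diag M · z)))
      }
      where
      rearrange : ∀ a d → (a xor true) xor (d xor true) ≡ a xor d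
      rearrange = truth-table 2 _

module ZeroRowPivot {n} {A : Fin n → Bool} {M : Matrix n} (M-sym : Symmetric M)
                    {i} (i∈A : A i ≡ true) (row-i≡0 : ∀ j → A j ≡ true → M i j ≡ false) where

  A′ : Fin n → Bool
  A′ = remove i A

  column-i≡0 : ∀ l → A l ≡ true → M l i ≡ false
  column-i≡0 l l∈A = trans (M-sym l i) (row-i≡0 l l∈A)

  δi∈Ker : Ker A M (δ i)
  δi∈Ker = (λ k k∉A → δ-≢ (λ { refl → contradiction (trans (sym i∈A) k∉A) λ () }))
         , λ l l∈A → trans (·-δʳ (M l) i) (column-i≡0 l l∈A)

  Ker-clear : ∀ {x} → Ker A M x → Ker A M (clear i x)
  Ker-clear {x} (x-supp , x∈ker) =
    Supported-remove⁻ (clear-supported x-supp) , λ l l∈A → trans (·-clear-irrelevant x (column-i≡0 l l∈A)) (x∈ker l l∈A)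

  Ker-remove⁻ : ∀ {x} → Ker A′ M x → Ker A M x × x i ≡ false
  Ker-remove⁻ {x} (x-supp , x∈ker) = (Supported-remove⁻ x-supp , rows) , x-supp i (remove-at i A)
    where
    rows : ∀ l → A l ≡ true → M l · x ≡ false
    rows l l∈A with i ≟ l
    ... | yes refl = ·-vanish (Supported-remove⁻ x-supp) row-i≡0
    ... | no  i≢l  = x∈ker l (trans (remove-other A i≢l) l∈A)

  Ker-remove⁺ : ∀ {x} → Ker A M x × x i ≡ false → Ker A′ M x
  Ker-remove⁺ ((x-supp , x∈ker) , xi≡0) = Supported-remove⁺ x-supp xi≡0 , λ l l∈A′ → x∈ker l (remove-⊆ A l∈A′)

  module _ {z} (z-solves : SolvesOn A M (diag M) z) where

    z′ : Vec₂ n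
    z′ = clear i z

    diag-solution : SolvesOn A′ M (diag M) z′
    diag-solution = clear-supported (proj₁ z-solves) , λ l l∈A′ →
      trans (·-clear-irrelevant z (column-i≡0 l (remove-⊆ A l∈A′))) (proj₂ z-solves l (remove-⊆ A l∈A′))

    diag·z′ : diag M · z′ ≡ diag M · z
    diag·z′ = ·-clear-irrelevant z (row-i≡0 i i∈A)

    reduction : Reduction A M z
    reduction = record
      { A′        = A′
      ; M′        = M
      ; z′        = z′
      ; smaller   = size-remove A i∈A
      ; symmetric = M-sym
      ; solves    = diag-solution
      ; lift      = λ (d , w , w-basis , parity-d) →
          suc d , δ i ∷ w , Basis-∷ δi∈Ker Ker-clear (Basis-resp-⇔ Ker-remove⁻ Ker-remove⁺ w-basis) ,
          trans (cong not (trans parity-d (cong₂ _xor_ (⊕-remove A i∈A) diag·z′))) (rearrange (⊕ A) (diag M · z))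
      }
      where
      rearrange : ∀ a d → not ((a xor true) xor d) ≡ a xor d
      rearrange = truth-table 2 _

module AlternatingPivot {n} {A : Fin n → Bool} {M : Matrix n} (M-sym : Symmetric M)
                        {i j} (i∈A : A i ≡ true) (j∈A : A j ≡ true)
                        (Mii≡0 : M i i ≡ false) (Mjj≡0 : M j j ≡ false) (Mij≡1 : M i j ≡ true) where

  i≢j : i ≢ j
  i≢j refl = contradiction (trans (sym Mii≡0) Mij≡1) λ ()

  Mji≡1 : M j i ≡ true
  Mji≡1 = trans (M-sym j i) Mij≡1

  A′ A″ : Fin n → Bool
  A′ = remove i A
  A″ = remove j A′

  j∈A′ : A′ j ≡ true
  j∈A′ = trans (remove-other A i≢j) j∈A

  A″-⊆ : ∀ {l} → A″ l ≡ true → A l ≡ true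
  A″-⊆ = remove-⊆ {i = i} A ∘ remove-⊆ {i = j} A′

  M″ : Matrix n
  M″ k l = (M k l xor M k i ∧ M j l) xor M k j ∧ M i l

  ·-M″ : ∀ l y → M″ l · y ≡ (M l · y xor M l i ∧ M j · y) xor M l j ∧ M i · y
  ·-M″ l y = trans (·-axpy (λ k → M l k xor M l i ∧ M j k) (M l j) (M i) y)
                   (cong (_xor M l j ∧ M i · y) (·-axpy (M l) (M l i) (M j) y))

  M″-symmetric : Symmetric M″
  M″-symmetric k l = trans (swap (M k l) (M k i) (M j l) (M k j) (M i l))
    (cong₂ _xor_ (cong₂ _xor_ (M-sym k l) (cong₂ _∧_ (M-sym i l) (M-sym k j))) (cong₂ _∧_ (M-sym j l) (M-sym k i)))
    where
    swap : ∀ a b c d e → (a xor b ∧ c) xor d ∧ e ≡ (a xor e ∧ d) xor c ∧ b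
    swap = truth-table 5 _

  M″-row-i : ∀ l → M″ i l ≡ false
  M″-row-i l = trans (cong₂ (λ u v → (M i l xor u ∧ M j l) xor v ∧ M i l) Mii≡0 Mij≡1) (cancel (M i l))
    where
    cancel : ∀ b → (b xor false) xor b ≡ false
    cancel = truth-table 1 _

  M″-row-j : ∀ l → M″ j l ≡ false
  M″-row-j l = trans (cong₂ (λ u v → (M j l xor u ∧ M j l) xor v ∧ M i l) Mji≡1 Mjj≡0) (cancel (M j l))
    where
    cancel : ∀ b → (b xor b) xor false ≡ false
    cancel = truth-table 1 _

  diag-M″ : ∀ l → M″ l l ≡ M l l
  diag-M″ l = trans (cong₂ (λ u v → (M l l xor M l i ∧ u) xor M l j ∧ v) (M-sym j l) (M-sym i l))
                    (cancel (M l l) (M l i) (M l j))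
    where
    cancel : ∀ a b c → (a xor b ∧ c) xor c ∧ b ≡ a
    cancel = truth-table 3 _

  ·-M″-clear : ∀ l x → M″ l · clear j (clear i x) ≡ M″ l · x
  ·-M″-clear l x = trans (·-clear-irrelevant (clear i x) (trans (M″-symmetric l j) (M″-row-j l)))
                         (·-clear-irrelevant x (trans (M″-symmetric l i) (M″-row-i l)))

  from : Vec₂ n → Vec₂ n
  from = transvection (δ j) (M i) ∘ transvection (δ i) (M j)

  ·-from : ∀ l y → M l · from y ≡ M″ l · y
  ·-from l y = begin
    M l · from y                                       ≡⟨ ·-transvectionᵟ (M l) j (M i) u ⟩
    M l · u xor M l j ∧ M i · u                        ≡⟨ cong₂ (λ p q → p xor M l j ∧ q) (·-transvectionᵟ (M l) i (M j) y) Mi·u ⟩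
    (M l · y xor M l i ∧ M j · y) xor M l j ∧ M i · y  ≡⟨ sym (·-M″ l y) ⟩
    M″ l · y                                           ∎
    where
    open ≡-Reasoning
    u = transvection (δ i) (M j) y
    Mi·u : M i · u ≡ M i · y
    Mi·u = trans (·-transvectionᵟ (M i) i (M j) y) (trans (cong (λ v → M i · y xor v ∧ M j · y) Mii≡0) (xor-identityʳ _))

  isomorphism : Ker A M ≃ Ker A″ M″
  isomorphism = record
    { to          = clear j ∘ clear i
    ; from        = from
    ; to-linear   = Linear-∘ (transvection-linear (δ j) (δ j)) (transvection-linear (δ i) (δ i))
    ; from-linear = Linear-∘ (transvection-linear (δ j) (M i)) (transvection-linear (δ i) (M j))
    ; to-∈        = to-∈
    ; from-∈      = from-∈
    ; to∘from     = to∘from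
    ; from∘to     = from∘to
    }
    where
    to-∈ : ∀ {x} → Ker A M x → Ker A″ M″ (clear j (clear i x))
    to-∈ {x} (x-supp , x∈ker) = clear-supported {i = j} (clear-supported x-supp) , λ l l∈A″ → begin
      M″ l · clear j (clear i x)                          ≡⟨ ·-M″-clear l x ⟩
      M″ l · x                                            ≡⟨ ·-M″ l x ⟩
      (M l · x xor M l i ∧ M j · x) xor M l j ∧ M i · x
        ≡⟨ cong₃ (λ p q r → (p xor M l i ∧ q) xor M l j ∧ r) (x∈ker l (A″-⊆ l∈A″)) (x∈ker j j∈A) (x∈ker i i∈A) ⟩
      (false xor M l i ∧ false) xor M l j ∧ false         ≡⟨ vanish (M l i) (M l j) ⟩
      false                                               ∎
      where
      open ≡-Reasoning
      vanish : ∀ b c → (false xor b ∧ false) xor c ∧ false ≡ false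
      vanish = truth-table 2 _
    from-∈ : ∀ {y} → Ker A″ M″ y → Ker A M (from y)
    from-∈ {y} (y-supp , y∈ker) =
      transvection-supported j∈A (transvection-supported i∈A (Supported-remove⁻ {i = i} (Supported-remove⁻ {i = j} y-supp))) ,
      λ l l∈A → trans (·-from l y) (M″-rows l l∈A)
      where
      M″-rows : ∀ l → A l ≡ true → M″ l · y ≡ false
      M″-rows l l∈A with i ≟ l | j ≟ l
      ... | yes refl | _        = ·-zeroˡ y M″-row-i
      ... | no  _    | yes refl = ·-zeroˡ y M″-row-j
      ... | no  i≢l  | no  j≢l  = y∈ker l (trans (remove-other A′ j≢l) (trans (remove-other A i≢l) l∈A))
    to∘from : ∀ {y} → Ker A″ M″ y → clear j (clear i (from y)) ≗ y
    to∘from {y} (y-supp , _) k = by-cases (j ≟ k) (i ≟ k)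
      where
      u = transvection (δ i) (M j) y
      v = transvection (δ j) (M i) u
      by-cases : Dec (j ≡ k) → Dec (i ≡ k) → clear j (clear i v) k ≡ y k
      by-cases (yes refl) _ = trans (clear-at j (clear i v)) (sym (y-supp j (remove-at j A′)))
      by-cases (no j≢k) (yes refl) =
        trans (transvection-other (δ j) (clear i v) j≢k)
              (trans (clear-at i v) (sym (y-supp i (trans (remove-other A′ (i≢j ∘ sym)) (remove-at i A)))))
      by-cases (no j≢k) (no i≢k) =
        trans (transvection-other (δ j) (clear i v) j≢k)
        (trans (transvection-other (δ i) v i≢k)
        (trans (transvection-other (M i) u j≢k) (transvection-other (M j) y i≢k)))
    from∘to : ∀ {x} → Ker A M x → from (clear j (clear i x)) ≗ x
    from∘to {x} (_ , x∈ker) k = begin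
      (v k xor δ i k ∧ M j · v) xor δ j k ∧ M i · w
        ≡⟨ cong₂ (λ p q → (v k xor δ i k ∧ p) xor δ j k ∧ q) Mj·v Mi·w ⟩
      (v k xor δ i k ∧ x i) xor δ j k ∧ x j
        ≡⟨ cong₂ (λ p q → (((x k xor δ i k ∧ p) xor δ j k ∧ q) xor δ i k ∧ x i) xor δ j k ∧ x j) (δ-· i x) δj·u ⟩
      (((x k xor δ i k ∧ x i) xor δ j k ∧ x j) xor δ i k ∧ x i) xor δ j k ∧ x j
        ≡⟨ cancel (x k) (δ i k ∧ x i) (δ j k ∧ x j) ⟩
      x k ∎
      where
      open ≡-Reasoning
      u = clear i x
      v = clear j u
      w = transvection (δ i) (M j) v
      uj≡xj : u j ≡ x j
      uj≡xj = transvection-other (δ i) x i≢j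
      δj·u : δ j · u ≡ x j
      δj·u = trans (δ-· j u) uj≡xj
      Mj·v : M j · v ≡ x i
      Mj·v = begin
        M j · v                   ≡⟨ ·-clear-irrelevant u Mjj≡0 ⟩
        M j · u                   ≡⟨ ·-clear (M j) i x ⟩
        M j · x xor M j i ∧ x i   ≡⟨ cong₂ (λ p q → p xor q ∧ x i) (x∈ker j j∈A) Mji≡1 ⟩
        x i                       ∎
      Mi·w : M i · w ≡ x j
      Mi·w = begin
        M i · w                        ≡⟨ ·-transvectionᵟ (M i) i (M j) v ⟩
        M i · v xor M i i ∧ M j · v    ≡⟨ cong (λ p → M i · v xor p ∧ M j · v) Mii≡0 ⟩
        M i · v xor false              ≡⟨ xor-identityʳ (M i · v) ⟩
        M i · v                        ≡⟨ ·-clear (M i) j u ⟩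
        M i · u xor M i j ∧ u j        ≡⟨ cong₂ (λ p q → p xor q ∧ u j) (·-clear-irrelevant x Mii≡0) Mij≡1 ⟩
        M i · x xor u j                ≡⟨ cong₂ _xor_ (x∈ker i i∈A) uj≡xj ⟩
        x j                            ∎
      cancel : ∀ a b c → (((a xor b) xor c) xor b) xor c ≡ a
      cancel = truth-table 3 _

  module _ {z} (z-solves : SolvesOn A M (diag M) z) where

    z″ : Vec₂ n
    z″ = clear j (clear i z)

    M″-diag-solution : SolvesOn A″ M″ (diag M″) z″
    M″-diag-solution = clear-supported {i = j} (clear-supported (proj₁ z-solves)) , λ l l∈A″ → begin
      M″ l · z″                                           ≡⟨ ·-M″-clear l z ⟩
      M″ l · z                                            ≡⟨ ·-M″ l z ⟩
      (M l · z xor M l i ∧ M j · z) xor M l j ∧ M i · z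
        ≡⟨ cong₃ (λ p q r → (p xor M l i ∧ q) xor M l j ∧ r) (solves l (A″-⊆ l∈A″)) (trans (solves j j∈A) Mjj≡0)
                                                             (trans (solves i i∈A) Mii≡0) ⟩
      (M l l xor M l i ∧ false) xor M l j ∧ false         ≡⟨ vanish (M l l) (M l i) (M l j) ⟩
      M l l                                               ≡⟨ sym (diag-M″ l) ⟩
      M″ l l                                              ∎
      where
      open ≡-Reasoning
      solves = proj₂ z-solves
      vanish : ∀ a b c → (a xor b ∧ false) xor c ∧ false ≡ a
      vanish = truth-table 3 _

    diag-M″·z″ : diag M″ · z″ ≡ diag M · z
    diag-M″·z″ = trans (·-congˡ diag-M″ z″) (trans (·-clear-irrelevant (clear i z) Mjj≡0) (·-clear-irrelevant z Mii≡0))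

    reduction : Reduction A M z
    reduction = record
      { A′        = A″
      ; M′        = M″
      ; z′        = z″
      ; smaller   = <-trans (size-remove A′ j∈A′) (size-remove A i∈A)
      ; symmetric = M″-symmetric
      ; solves    = M″-diag-solution
      ; lift      = λ (d , w , w-basis , parity-d) →
          d , from ∘ w , Basis-transport isomorphism w-basis ,
          trans parity-d (trans (cong₂ _xor_ ⊕-A″ diag-M″·z″) (rearrange (⊕ A) (diag M · z)))
      }
      where
      ⊕-A″ : ⊕ A″ ≡ (⊕ A xor true) xor true
      ⊕-A″ = trans (⊕-remove A′ j∈A′) (cong (_xor true) (⊕-remove A i∈A))
      rearrange : ∀ a d → ((a xor true) xor true) xor d ≡ a xor d
      rearrange = truth-table 2 _

reduce : ∀ {n} {A : Fin n → Bool} {M : Matrix n} {z i} → Symmetric M → SolvesOn A M (diag M) z →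
         A i ≡ true → Reduction A M z
reduce {A = A} {M} {i = i} M-sym z-solves i∈A with M i i ≟ᵇ true
... | yes Mii≡1 = DiagonalPivot.reduction M-sym i∈A Mii≡1 z-solves
... | no  Mii≢1 with any? (λ j → A j ∧ M i j ≟ᵇ true)
...   | no  row-i≡0 = ZeroRowPivot.reduction M-sym i∈A row-i-vanishes z-solves
  where
  row-i-vanishes : ∀ j → A j ≡ true → M i j ≡ false
  row-i-vanishes j j∈A = ¬-not (λ Mij≡1 → row-i≡0 (j , cong₂ _∧_ j∈A Mij≡1))
...   | yes (j , j∈A∧Mij≡1) with M j j ≟ᵇ true
...     | yes Mjj≡1 = DiagonalPivot.reduction M-sym (∧-conicalˡ _ _ j∈A∧Mij≡1) Mjj≡1 z-solves
...     | no  Mjj≢1 = AlternatingPivot.reduction M-sym i∈A (∧-conicalˡ _ _ j∈A∧Mij≡1)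
                        (¬-not Mii≢1) (¬-not Mjj≢1) (∧-conicalʳ _ _ j∈A∧Mij≡1) z-solves

empty-kernel-parity : ∀ {n} {A : Fin n → Bool} {M : Matrix n} {z} → (∀ k → A k ≡ false) →
                      SolvesOn A M (diag M) z → KernelParity A M z
empty-kernel-parity {M = M} A≡∅ (z-supp , _) =
  0 , (λ ()) , ((λ ()) , (λ _ _ ()) , λ x (x-supp , _) → (λ ()) , λ k → sym (x-supp k (A≡∅ k))) ,
  sym (cong₂ _xor_ (⊕-zero A≡∅) (⊕-zero (λ k → trans (cong (M k k ∧_) (z-supp k (A≡∅ k))) (∧-zeroʳ (M k k)))))

kernel-parity : ∀ {n} {A : Fin n → Bool} {M : Matrix n} {z} → Acc _<_ (size A) →
                Symmetric M → SolvesOn A M (diag M) z → KernelParity A M z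
kernel-parity {A = A} (acc rec) M-sym z-solves with any? (λ i → A i ≟ᵇ true)
... | no  A≡∅       = empty-kernel-parity (λ k → ¬-not (λ k∈A → A≡∅ (k , k∈A))) z-solves
... | yes (i , i∈A) = lift (kernel-parity (rec smaller) symmetric solves)
  where open Reduction (reduce M-sym z-solves i∈A)

-- The closed neighbourhood matrix

parity-size : ∀ {m} (f : Fin m → Bool) → parity (size f) ≡ ⊕ f
parity-size {zero}  f = refl
parity-size {suc m} f with f zero
... | true  = cong not (parity-size (f ∘ suc))
... | false = parity-size (f ∘ suc)

Even⇒parity≡false : ∀ {m} → Even m → parity m ≡ false
Even⇒parity≡false (divides q refl) = parity-double q
  where
  parity-double : ∀ q → parity (q * 2) ≡ false
  parity-double zero    = refl
  parity-double (suc q) = trans (not-involutive _) (parity-double q)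

parity≡false⇒Even : ∀ m → parity m ≡ false → Even m
parity≡false⇒Even zero          _   = 2 ∣0
parity≡false⇒Even (suc zero)    ()
parity≡false⇒Even (suc (suc m)) h = ∣m∣n⇒∣m+n ∣-refl (parity≡false⇒Even m (trans (sym (not-involutive _)) h))

𝟙 : ∀ {n} → Vec₂ n
𝟙 _ = true

module _ {n} (G : SimpleGraph n) where

  N-symmetric : Symmetric (N G)
  N-symmetric k l = cong₂ _xor_ (symm G k l) (δ-sym k l)

  N-diag : ∀ k → N G k k ≡ true
  N-diag k = cong₂ _xor_ (irrefl G k) (δ-refl k)

  ⊕𝟙-xor-N-diag·𝟙 : ⊕ (𝟙 {n}) xor diag (N G) · 𝟙 ≡ false
  ⊕𝟙-xor-N-diag·𝟙 =
    trans (cong (⊕ (𝟙 {n}) xor_) (⊕-cong (λ k → trans (∧-identityʳ (N G k k)) (N-diag k)))) (xor-same (⊕ (𝟙 {n})))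

  N·𝟙 : (∀ i → Even (degree G i)) → ∀ l → N G l · 𝟙 ≡ true
  N·𝟙 even l = begin
    N G l · 𝟙                    ≡⟨ ⊕-cong (λ k → ∧-identityʳ (N G l k)) ⟩
    ⊕ (N G l)                    ≡⟨ ⊕-xor (adj G l) (δ l) ⟩
    ⊕ (adj G l) xor ⊕ (δ l)      ≡⟨ cong₂ _xor_ ⊕-adj (⊕-δ-self l) ⟩
    true                         ∎
    where
    open ≡-Reasoning
    ⊕-adj : ⊕ (adj G l) ≡ false
    ⊕-adj = trans (sym (parity-size (adj G l))) (Even⇒parity≡false (even l))

  𝟙-solves : (∀ i → Even (degree G i)) → SolvesOn 𝟙 (N G) (diag (N G)) 𝟙
  𝟙-solves even = (λ _ ()) , λ l _ → trans (N·𝟙 even l) (sym (N-diag l))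

  Ker⇒InKernel : ∀ {x} → Ker 𝟙 (N G) x → InKernel G x
  Ker⇒InKernel (_ , x∈ker) l = x∈ker l refl

  InKernel⇒Ker : ∀ {x} → InKernel G x → Ker 𝟙 (N G) x
  InKernel⇒Ker x∈ker = (λ _ ()) , λ l _ → x∈ker l

corollary3p2 : ∀ {n} (G : SimpleGraph n) →
    (∀ i → Even (degree G i)) →
    ∀ d → IsNullity G d → Even d
corollary3p2 {n} G even d (v , v-basis)
  with kernel-parity (<-wellFounded _) (N-symmetric G) (𝟙-solves G even)
... | d′ , w , w-basis , parity-d′ = parity≡false⇒Even d (begin
  parity d
    ≡⟨ cong parity (Basis-size-unique v-basis (Basis-resp-⇔ (Ker⇒InKernel G) (InKernel⇒Ker G) w-basis)) ⟩
  parity d′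
    ≡⟨ parity-d′ ⟩
  ⊕ (𝟙 {n}) xor diag (N G) · 𝟙
    ≡⟨ ⊕𝟙-xor-N-diag·𝟙 G ⟩
  false
    ∎)
  where open ≡-Reasoning
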